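{- Let $\mathcal{L}=\langle S, Act_\tau,\to\rangle$ be a labelled transition system of processes. Suppose $\phi$ is a formula in $\mathrm{recHML}$ which is may-testable, i.e. there is a test $t$ (a closed term of the test language) such that for every $p\in S$, $p\ \mathbf{may\ satisfy}\ t$ if and only if $p\in[\![\phi]\!]$. Then there exists some $\psi\in\mathrm{mayHML}$ which is logically equivalent to $\phi$, i.e. $[\![\psi]\!]=[\![\phi]\!]$.
   Context: **Labelled transition systems.** An LTS over a countable set $Act$ of external actions is a triple $\langle S,Act_\tau,\to\rangle$ with $S$ a countable set of states (processes), $Act_\tau=Act\cup\{\tau\}$ where $\tau\notin Act$, and $\to\subseteq S\times Act_\tau\times S$; write $s\xrightarrow{\alpha}s'$ for $(s,\alpha,s')\in\to$, and $s\xrightarrow{\alpha}$ if such an $s'$ exists. The letter $a$ ranges over $Act$, $\alpha$ over $Act_\tau$. $s\Uparrow$ (diverges) if there is an infinite path $s\xrightarrow{\tau}s_1\xrightarrow{\tau}\cdots$; otherwise $s\Downarrow$ (converges). Weak transitions: $\stackrel{\tau}{\Rightarrow}$ is the reflexive transitive closure of $\xrightarrow{\tau}$, and $s\stackrel{a}{\Rightarrow}s'$ means $s\stackrel{\tau}{\Rightarrow}s''\xrightarrow{a}s'''\stackrel{\tau}{\Rightarrow}s'$ for some $s'',s'''$; $s\stackrel{\alpha}{\Rightarrow}$ means $s\stackrel{\alpha}{\Rightarrow}s'$ for some $s'$. **The languages recHML and mayHML.** $\mathrm{recHML}$ is the set of closed formulae generated by $\phi ::= \mathtt{tt}\mid\mathtt{ff}\mid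 X\mid \mathrm{Acc}\,A\mid\phi_1\vee\phi_2\mid\phi_1\wedge\phi_2\mid\langle\alpha\rangle\phi\mid[\alpha]\phi\mid\min(X,\phi)\mid\max(X,\phi)$, where $X$ ranges over a countable set $Var$ of variables, $\alpha\in Act_\tau$, $A$ is a finite subset of $Act$, and $\min(X,\cdot)$, $\max(X,\cdot)$ bind $X$. $\mathrm{mayHML}$ is the set of closed formulae generated by the fragment $\phi ::= \mathtt{tt}\mid\mathtt{ff}\mid X\mid\langle\alpha\rangle\phi\mid\phi_1\vee\phi_2\mid \min(X,\phi)$. Given an environment $\rho:Var\to 2^S$: $[\![\mathtt{tt}]\!]\rho=S$; $[\![\mathtt{ff}]\!]\rho=\emptyset$; $[\![X]\!]\rho=\rho(X)$; $[\![\mathrm{Acc}\,A]\!]\rho=\{s : s\Downarrow,\text{ and } s\stackrel{\tau}{\Rightarrow}s'\text{ implies } s'\stackrel{a}{\Rightarrow}\text{ for some }a\in A\}$; $[\![\langle\alpha\rangle\phi]\!]\rho=\{s : s\stackrel{\alpha}{\Rightarrow}s'\text{ for some }s'\in[\![\phi]\!]\rho\}$; $[\![[\alpha]\phi]\!]\rho=\{s : s\Downarrow,\text{ and } s\stackrel{\alpha}{\Rightarrow}s'\text{ implies }s'\in[\![\phi]\!]\rho\}$; $\vee,\wedge$ are union and intersection; $[\![\min(X,\phi)]\!]\rho=\bigcap\{P\subseteq S : [\![\phi]\!]\rho[X\mapsto P]\subseteq P\}$; $[\![\max(X,\phi)]\!]\rho=\bigcup\{P\subseteq S : P\subseteq[\![\phi]\!]\rho[X\mapsto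 P]\}$. For closed $\phi$ the environment is omitted. **Tests.** Let $\omega\notin Act_\tau$. Tests are the closed terms of $t::=0\mid\alpha.t\mid\omega.0\mid X\mid t_1+t_2\mid\mu X.t$ ($\alpha\in Act_\tau$, $\mu X$ binds $X$), with transitions given by the rules: $\alpha.t\xrightarrow{\alpha}t$ for $\alpha\in Act_\tau\cup\{\omega\}$; if $t_i\xrightarrow{\alpha}t'$ for $i=1$ or $i=2$ then $t_1+t_2\xrightarrow{\alpha}t'$; $\mu X.t\xrightarrow{\tau}t\{\mu X.t/X\}$. **Testing.** For a process $p$ and test $t$, the experiment $p\,|\,t$ has only $\tau$-moves: $p|t\to p'|t$ if $p\xrightarrow{\tau}p'$; $p|t\to p|t'$ if $t\xrightarrow{\tau}t'$; $p|t\to p'|t'$ if $p\xrightarrow{a}p'$ and $t\xrightarrow{a}t'$ for some $a\in Act$. A computation of $p|t$ is a maximal (finite or infinite) path $p|t\to p_1|t_1\to\cdots$ (with $p_0=p$, $t_0=t$); it is successful if $t_n\xrightarrow{\omega}$ for some $n\ge0$. $p\ \mathbf{may\ satisfy}\ t$ if there exists a successful computation of $p|t$. -}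

module Defs where

open import Level using (0ℓ; suc; Lift)
open import Data.Bool.Base using (if_then_else_)
open import Data.Empty using (⊥)
import Data.Empty.Polymorphic as Poly
import Data.Unit.Polymorphic as Poly
open import Data.Fin.Base using (Fin; zero; fromℕ; inject₁)
import Data.Fin.Base as Fin
open import Data.List.Base using (List)
open import Data.List.Membership.Propositional using (_∈_)
open import Data.Nat.Base using (ℕ)
import Data.Nat.Base as ℕ
open import Data.Nat.Properties using (_≟_)
open import Data.Product.Base using (Σ; ∃-syntax; _×_; _,_)
open import Data.Sum.Base using (_⊎_)
open import Function.Bundles using (_↣_; _⇔_)
open import Relation.Binary.Construct.Closure.ReflexiveTransitive using (Star)
open import Relation.Binary.Core using (Rel)
open import Relation.Binary.PropositionalEquality using (_≡_; _≢_)
open import Relation.Nullary using (¬_; does)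
open import Relation.Unary using (Pred; ∅; _⊆_)

-- Finite sets, the empty one included, count as countable.
Countable : Set → Set
Countable A = A ↣ ℕ

record InfinitePath {A : Set} (_⟶_ : Rel A 0ℓ) (x : A) : Set where
  field
    state : ℕ → A
    start : state 0 ≡ x
    step  : ∀ n → state n ⟶ state (ℕ.suc n)

data Action (Act : Set) : Set where
  τ   : Action Act
  ext : Act → Action Act

record LTS (Act : Set) : Set₁ where
  field
    S           : Set
    S-countable : Countable S
    _-[_]→_     : S → Action Act → S → Set

  _-τ→_ : Rel S 0ℓ
  s -τ→ s′ = s -[ τ ]→ s′

  _⇑ : S → Set
  s ⇑ = InfinitePath _-τ→_ s

  _⇓ : S → Set
  s ⇓ = ¬ (s ⇑)

  _=[_]⇒_ : S → Action Act → S → Set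
  s =[ τ ]⇒ s′     = Star _-τ→_ s s′
  s =[ ext a ]⇒ s′ =
    ∃[ u ] ∃[ v ] Star _-τ→_ s u × u -[ ext a ]→ v × Star _-τ→_ v s′

  _=[_]⇒ : S → Action Act → Set
  s =[ α ]⇒ = ∃[ s′ ] s =[ α ]⇒ s′

Var : Set
Var = ℕ

_[_↦_] : ∀ {ℓ} {A : Set ℓ} → (Var → A) → Var → A → (Var → A)
(ρ [ X ↦ P ]) Y = if does (X ≟ Y) then P else ρ Y

-- Formulae, possibly open.  A finite set of actions is given by a list, of
-- which only membership is used.
data Formula (Act : Set) : Set where
  tt ff   : Formula Act
  var     : Var → Formula Act
  Acc     : List Act → Formula Act
  _∨_ _∧_ : Formula Act → Formula Act → Formula Act
  ⟨_⟩_    : Action Act → Formula Act → Formula Act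
  [_]_    : Action Act → Formula Act → Formula Act
  min max : Var → Formula Act → Formula Act

_FreeIn_ : ∀ {Act} → Var → Formula Act → Set
X FreeIn tt        = ⊥
X FreeIn ff        = ⊥
X FreeIn var Y     = X ≡ Y
X FreeIn Acc A     = ⊥
X FreeIn (φ₁ ∨ φ₂) = X FreeIn φ₁ ⊎ X FreeIn φ₂
X FreeIn (φ₁ ∧ φ₂) = X FreeIn φ₁ ⊎ X FreeIn φ₂
X FreeIn (⟨ α ⟩ φ) = X FreeIn φ
X FreeIn ([ α ] φ) = X FreeIn φ
X FreeIn min Y φ   = X ≢ Y × X FreeIn φ
X FreeIn max Y φ   = X ≢ Y × X FreeIn φ

Closed : ∀ {Act} → Formula Act → Set
Closed φ = ∀ X → ¬ (X FreeIn φ)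

recHML : Set → Set
recHML Act = Σ (Formula Act) Closed

data MayFragment {Act : Set} : Formula Act → Set where
  tt   : MayFragment tt
  ff   : MayFragment ff
  var  : ∀ X → MayFragment (var X)
  ⟨_⟩_ : ∀ α {φ} → MayFragment φ → MayFragment (⟨ α ⟩ φ)
  _∨_  : ∀ {φ₁ φ₂} → MayFragment φ₁ → MayFragment φ₂ → MayFragment (φ₁ ∨ φ₂)
  min  : ∀ X {φ} → MayFragment φ → MayFragment (min X φ)

mayHML : Set → Set
mayHML Act = Σ (Formula Act) λ φ → MayFragment φ × Closed φ

module Semantics {Act : Set} (L : LTS Act) where
  open LTS L

  Env : Set₁
  Env = Var → Pred S 0ℓ

  -- The powerset 2^S is Pred S 0ℓ.  Because min and max quantify over it, a
  -- denotation lands one universe higher; under excluded middle at that level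
  -- every such denotation agrees with a predicate in Pred S 0ℓ, so the two
  -- levels describe the same subsets.
  ⟦_⟧_ : Formula Act → Env → Pred S (suc 0ℓ)
  (⟦ tt ⟧ ρ) s        = Poly.⊤
  (⟦ ff ⟧ ρ) s        = Poly.⊥
  (⟦ var X ⟧ ρ) s     = Lift (suc 0ℓ) (ρ X s)
  (⟦ Acc A ⟧ ρ) s     = Lift (suc 0ℓ)
    (s ⇓ × (∀ s′ → s =[ τ ]⇒ s′ → ∃[ a ] a ∈ A × s′ =[ ext a ]⇒))
  (⟦ φ₁ ∨ φ₂ ⟧ ρ) s   = (⟦ φ₁ ⟧ ρ) s ⊎ (⟦ φ₂ ⟧ ρ) s
  (⟦ φ₁ ∧ φ₂ ⟧ ρ) s   = (⟦ φ₁ ⟧ ρ) s × (⟦ φ₂ ⟧ ρ) s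
  (⟦ ⟨ α ⟩ φ ⟧ ρ) s   = ∃[ s′ ] s =[ α ]⇒ s′ × (⟦ φ ⟧ ρ) s′
  (⟦ [ α ] φ ⟧ ρ) s   = s ⇓ × (∀ s′ → s =[ α ]⇒ s′ → (⟦ φ ⟧ ρ) s′)
  (⟦ min X φ ⟧ ρ) s   =
    ∀ (P : Pred S 0ℓ) → ⟦ φ ⟧ (ρ [ X ↦ P ]) ⊆ P → P s
  (⟦ max X φ ⟧ ρ) s   =
    Σ (Pred S 0ℓ) λ P → P ⊆ ⟦ φ ⟧ (ρ [ X ↦ P ]) × P s

  -- Only applied to closed formulae, whose denotation does not depend on the
  -- environment.
  _⊨_ : S → Formula Act → Set₁
  s ⊨ φ = (⟦ φ ⟧ (λ _ → ∅)) s

-- Test terms, possibly open.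
data Term (Act : Set) : Set where
  𝟘    : Term Act
  _∙_  : Action Act → Term Act → Term Act
  ω∙𝟘  : Term Act
  var  : Var → Term Act
  _⊕_  : Term Act → Term Act → Term Act
  μ    : Var → Term Act → Term Act

_FreeInTerm_ : ∀ {Act} → Var → Term Act → Set
X FreeInTerm 𝟘         = ⊥
X FreeInTerm (α ∙ t)   = X FreeInTerm t
X FreeInTerm ω∙𝟘       = ⊥
X FreeInTerm var Y     = X ≡ Y
X FreeInTerm (t₁ ⊕ t₂) = X FreeInTerm t₁ ⊎ X FreeInTerm t₂
X FreeInTerm μ Y t     = X ≢ Y × X FreeInTerm t

ClosedTerm : ∀ {Act} → Term Act → Set
ClosedTerm t = ∀ X → ¬ (X FreeInTerm t)

Test : Set → Set
Test Act = Σ (Term Act) ClosedTerm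

-- t ⟪ u / X ⟫ replaces the free occurrences of X in t by u without renaming
-- bound variables.  No capture can occur when u is closed, which is always so
-- when unfolding recursion in a closed term.
_⟪_/_⟫ : ∀ {Act} → Term Act → Term Act → Var → Term Act
𝟘 ⟪ u / X ⟫         = 𝟘
(α ∙ t) ⟪ u / X ⟫   = α ∙ (t ⟪ u / X ⟫)
ω∙𝟘 ⟪ u / X ⟫       = ω∙𝟘
var Y ⟪ u / X ⟫     = if does (X ≟ Y) then u else var Y
(t₁ ⊕ t₂) ⟪ u / X ⟫ = (t₁ ⟪ u / X ⟫) ⊕ (t₂ ⟪ u / X ⟫)
μ Y t ⟪ u / X ⟫     = if does (X ≟ Y) then μ Y t else μ Y (t ⟪ u / X ⟫)

data TestAction (Act : Set) : Set where
  act : Action Act → TestAction Act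
  ω   : TestAction Act

data _-⟨_⟩→_ {Act : Set} : Term Act → TestAction Act → Term Act → Set where
  prefix  : ∀ {α t} → (α ∙ t) -⟨ act α ⟩→ t
  success : ω∙𝟘 -⟨ ω ⟩→ 𝟘
  sumˡ    : ∀ {t₁ t₂ β t′} → t₁ -⟨ β ⟩→ t′ → (t₁ ⊕ t₂) -⟨ β ⟩→ t′
  sumʳ    : ∀ {t₁ t₂ β t′} → t₂ -⟨ β ⟩→ t′ → (t₁ ⊕ t₂) -⟨ β ⟩→ t′
  unfold  : ∀ {X t} → μ X t -⟨ act τ ⟩→ (t ⟪ μ X t / X ⟫)

module Testing {Act : Set} (L : LTS Act) where
  open LTS L
  open Semantics L

  Experiment : Set
  Experiment = S × Term Act

  data _⟶_ : Rel Experiment 0ℓ where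
    process : ∀ {p p′ t} → p -[ τ ]→ p′ → (p , t) ⟶ (p′ , t)
    test    : ∀ {p t t′} → t -⟨ act τ ⟩→ t′ → (p , t) ⟶ (p , t′)
    sync    : ∀ {p p′ t t′} a → p -[ ext a ]→ p′ → t -⟨ act (ext a) ⟩→ t′ →
              (p , t) ⟶ (p′ , t′)

  data Computation (e : Experiment) : Set where
    finite   : (n : ℕ) (state : Fin (ℕ.suc n) → Experiment) →
               state zero ≡ e →
               (∀ i → state (inject₁ i) ⟶ state (Fin.suc i)) →
               (∀ e′ → ¬ (state (fromℕ n) ⟶ e′)) →
               Computation e
    infinite : InfinitePath _⟶_ e → Computation e

  CanSucceed : Experiment → Set
  CanSucceed (p , t) = ∃[ t′ ] t -⟨ ω ⟩→ t′

  Successful : ∀ {e} → Computation e → Set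
  Successful (finite n state _ _ _) = ∃[ i ] CanSucceed (state i)
  Successful (infinite path)        = ∃[ n ] CanSucceed (InfinitePath.state path n)

  _MaySatisfy_ : S → Test Act → Set
  p MaySatisfy (t , _) = Σ (Computation (p , t)) Successful

  MayTestable : recHML Act → Set₁
  MayTestable (φ , _) = Σ (Test Act) λ t → ∀ p → p MaySatisfy t ⇔ p ⊨ φ

-- Extensional equality of denotations as subsets of S.
LogicallyEquivalent : ∀ {Act} → LTS Act → Formula Act → Formula Act → Set₁
LogicallyEquivalent L ψ φ = ∀ (s : LTS.S L) → s ⊨ ψ ⇔ s ⊨ φ
  where open Semantics L

{-# OPTIONS --safe #-}

-- Reading recursion as a least fixed point turns a test t into a mayHML formula
-- ⌈ t ⌉.  If p ⊨ ⌈ t ⌉, then p | t can reach success: the processes that may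
-- succeed with μ X t form a pre-fixed point of the body of min X ⌈ t ⌉.
-- Conversely, ⌈ t ⌉ is preserved backwards along the steps of an experiment,
-- because mayHML properties are closed under τ-predecessors and unfolding a
-- recursion does not leave any pre-fixed point.  Excluded middle is what extends
-- a successful finite path to a maximal one.
module Submission where

open import Level using (0ℓ; suc; Lift; lift; lower)
open import Axiom.ExcludedMiddle using (ExcludedMiddle)
open import Data.Bool.Base using (true; false)
open import Data.Empty using (⊥-elim)
open import Data.Fin.Base using (Fin; zero; inject₁)
import Data.Fin.Base as Fin
open import Data.Nat.Base using (ℕ)
import Data.Nat.Base as ℕ
open import Data.Nat.Properties using (_≟_)
open import Data.Product.Base using (Σ; ∃-syntax; _×_; _,_; proj₁; proj₂)
open import Data.Sum.Base using (inj₁; inj₂)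
open import Function.Base using (_∘_)
open import Function.Bundles using (_⇔_; mk⇔; Equivalence)
open import Relation.Binary.Construct.Closure.ReflexiveTransitive
  using (Star; ε; _◅_; _◅◅_)
open import Relation.Binary.PropositionalEquality
  using (_≡_; _≢_; refl; sym; trans; cong; cong₂; subst)
open import Relation.Nullary using (¬_; Dec; yes; no; does; proof; ofʸ; ofⁿ)
open import Relation.Nullary.Decidable.Core using (map′)
open import Relation.Unary using (Pred; ∅; _⊆_)
open import Defs

-- Translation of tests into formulae

⌈_⌉ : ∀ {Act} → Term Act → Formula Act
⌈ 𝟘 ⌉       = ff
⌈ α ∙ t ⌉   = ⟨ α ⟩ ⌈ t ⌉
⌈ ω∙𝟘 ⌉     = tt
⌈ var X ⌉   = var X
⌈ t₁ ⊕ t₂ ⌉ = ⌈ t₁ ⌉ ∨ ⌈ t₂ ⌉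
⌈ μ X t ⌉   = min X ⌈ t ⌉

⌈⌉-mayFragment : ∀ {Act} (t : Term Act) → MayFragment ⌈ t ⌉
⌈⌉-mayFragment 𝟘         = ff
⌈⌉-mayFragment (α ∙ t)   = ⟨ α ⟩ ⌈⌉-mayFragment t
⌈⌉-mayFragment ω∙𝟘       = tt
⌈⌉-mayFragment (var X)   = var X
⌈⌉-mayFragment (t₁ ⊕ t₂) = ⌈⌉-mayFragment t₁ ∨ ⌈⌉-mayFragment t₂
⌈⌉-mayFragment (μ X t)   = min X (⌈⌉-mayFragment t)

free-⌈⌉ : ∀ {Act X} (t : Term Act) → X FreeIn ⌈ t ⌉ → X FreeInTerm t
free-⌈⌉ (α ∙ t)   f         = free-⌈⌉ t f
free-⌈⌉ (var X)   f         = f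
free-⌈⌉ (t₁ ⊕ t₂) (inj₁ f)  = inj₁ (free-⌈⌉ t₁ f)
free-⌈⌉ (t₁ ⊕ t₂) (inj₂ f)  = inj₂ (free-⌈⌉ t₂ f)
free-⌈⌉ (μ X t)   (X≢ , f)  = X≢ , free-⌈⌉ t f

-- Substitution

module _ {ℓ} {A : Set ℓ} (ρ : Var → A) (X : Var) (P : A) where

  update-same : (ρ [ X ↦ P ]) X ≡ P
  -- Updates branch on the Boolean alone: abstracting `does` lets the conditional reduce, and
  -- abstracting `proof` recovers what the Boolean means.
  update-same with does (X ≟ X) | proof (X ≟ X)
  ... | _ | ofʸ _   = refl
  ... | _ | ofⁿ X≢X = ⊥-elim (X≢X refl)

  update-other : ∀ {Y} → X ≢ Y → (ρ [ X ↦ P ]) Y ≡ ρ Y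
  update-other {Y} X≢Y with does (X ≟ Y) | proof (X ≟ Y)
  ... | _ | ofʸ X≡Y = ⊥-elim (X≢Y X≡Y)
  ... | _ | ofⁿ _   = refl

module _ {Act : Set} where

  -- As `u` is closed, it contributes no free variables. The conjunct `X ≢ Z` is what makes a free
  -- variable of an unfolding free in the recursion as well.
  free-⟪⟫ : ∀ {X Z} {u : Term Act} → ClosedTerm u → (t : Term Act) →
            Z FreeInTerm (t ⟪ u / X ⟫) → X ≢ Z × Z FreeInTerm t
  free-⟪⟫ cu (α ∙ t) f = free-⟪⟫ cu t f
  free-⟪⟫ {X} cu (var Y) f with does (X ≟ Y) | proof (X ≟ Y)
  ... | _ | ofʸ _   = ⊥-elim (cu _ f)
  free-⟪⟫ {X} cu (var Y) refl | _ | ofⁿ X≢Y = X≢Y , refl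
  free-⟪⟫ cu (t₁ ⊕ t₂) (inj₁ f) = let X≢Z , g = free-⟪⟫ cu t₁ f in X≢Z , inj₁ g
  free-⟪⟫ cu (t₁ ⊕ t₂) (inj₂ f) = let X≢Z , g = free-⟪⟫ cu t₂ f in X≢Z , inj₂ g
  free-⟪⟫ {X} cu (μ Y t) f with does (X ≟ Y) | proof (X ≟ Y)
  free-⟪⟫ cu (μ Y t) (Z≢Y , f) | _ | ofʸ refl = Z≢Y ∘ sym , Z≢Y , f
  free-⟪⟫ cu (μ Y t) (Z≢Y , f) | _ | ofⁿ _    =
    let X≢Z , g = free-⟪⟫ cu t f in X≢Z , Z≢Y , g

  closed-unfold : ∀ {X} (t : Term Act) → ClosedTerm (μ X t) →
                  ClosedTerm (t ⟪ μ X t / X ⟫)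
  closed-unfold t c Z f =
    let X≢Z , g = free-⟪⟫ c t f in c Z (X≢Z ∘ sym , g)

  closed-step : ∀ {t t′ : Term Act} {β} → ClosedTerm t → t -⟨ β ⟩→ t′ →
                ClosedTerm t′
  closed-step c prefix   = c
  closed-step c success  = λ _ ()
  closed-step c (sumˡ r) = closed-step (λ X → c X ∘ inj₁) r
  closed-step c (sumʳ r) = closed-step (λ X → c X ∘ inj₂) r
  closed-step c (unfold {t = t}) = closed-unfold t c

  ⟪⟫-fresh : ∀ {X} {u : Term Act} (t : Term Act) → ¬ (X FreeInTerm t) →
             t ⟪ u / X ⟫ ≡ t
  ⟪⟫-fresh 𝟘         X∉t = refl
  ⟪⟫-fresh (α ∙ t)   X∉t = cong (α ∙_) (⟪⟫-fresh t X∉t)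
  ⟪⟫-fresh ω∙𝟘       X∉t = refl
  ⟪⟫-fresh {X} (var Y) X∉t with does (X ≟ Y) | proof (X ≟ Y)
  ... | _ | ofʸ X≡Y = ⊥-elim (X∉t X≡Y)
  ... | _ | ofⁿ _   = refl
  ⟪⟫-fresh (t₁ ⊕ t₂) X∉t =
    cong₂ _⊕_ (⟪⟫-fresh t₁ (X∉t ∘ inj₁)) (⟪⟫-fresh t₂ (X∉t ∘ inj₂))
  ⟪⟫-fresh {X} (μ Y t) X∉t with does (X ≟ Y) | proof (X ≟ Y)
  ... | _ | ofʸ _   = refl
  ... | _ | ofⁿ X≢Y = cong (μ Y) (⟪⟫-fresh t λ f → X∉t (X≢Y , f))

  -- Capture-free only when the substituted terms are closed.
  _⟪_⟫ : Term Act → (Var → Term Act) → Term Act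
  𝟘         ⟪ σ ⟫ = 𝟘
  (α ∙ t)   ⟪ σ ⟫ = α ∙ (t ⟪ σ ⟫)
  ω∙𝟘       ⟪ σ ⟫ = ω∙𝟘
  var X     ⟪ σ ⟫ = σ X
  (t₁ ⊕ t₂) ⟪ σ ⟫ = (t₁ ⟪ σ ⟫) ⊕ (t₂ ⟪ σ ⟫)
  μ X t     ⟪ σ ⟫ = μ X (t ⟪ σ [ X ↦ var X ] ⟫)

  parallel-cong : ∀ (t : Term Act) {σ σ′} →
                  (∀ X → X FreeInTerm t → σ X ≡ σ′ X) → t ⟪ σ ⟫ ≡ t ⟪ σ′ ⟫
  parallel-cong 𝟘         h = refl
  parallel-cong (α ∙ t)   h = cong (α ∙_) (parallel-cong t h)
  parallel-cong ω∙𝟘       h = refl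
  parallel-cong (var X)   h = h X refl
  parallel-cong (t₁ ⊕ t₂) h =
    cong₂ _⊕_ (parallel-cong t₁ λ X → h X ∘ inj₁)
              (parallel-cong t₂ λ X → h X ∘ inj₂)
  parallel-cong (μ X t) {σ} {σ′} h = cong (μ X) (parallel-cong t agree)
    where
    agree : ∀ Z → Z FreeInTerm t → (σ [ X ↦ var X ]) Z ≡ (σ′ [ X ↦ var X ]) Z
    agree Z f with does (X ≟ Z) | proof (X ≟ Z)
    ... | _ | ofʸ _   = refl
    ... | _ | ofⁿ X≢Z = h Z (X≢Z ∘ sym , f)

  parallel-var : ∀ (t : Term Act) → t ⟪ var ⟫ ≡ t
  parallel-var 𝟘         = refl
  parallel-var (α ∙ t)   = cong (α ∙_) (parallel-var t)
  parallel-var ω∙𝟘       = refl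
  parallel-var (var X)   = refl
  parallel-var (t₁ ⊕ t₂) = cong₂ _⊕_ (parallel-var t₁) (parallel-var t₂)
  parallel-var (μ X t)   =
    cong (μ X) (trans (parallel-cong t (λ Z _ → agree Z)) (parallel-var t))
    where
    agree : ∀ Z → (var [ X ↦ var X ]) Z ≡ var Z
    agree Z with does (X ≟ Z) | proof (X ≟ Z)
    ... | _ | ofʸ refl = refl
    ... | _ | ofⁿ _    = refl

  parallel-closed : ∀ {t : Term Act} {σ} → ClosedTerm t → t ⟪ σ ⟫ ≡ t
  parallel-closed {t} c =
    trans (parallel-cong t λ X f → ⊥-elim (c X f)) (parallel-var t)

  free-parallel : ∀ {Z} (t : Term Act) {σ} → (∀ X → ¬ (Z FreeInTerm σ X)) →
                  ¬ (Z FreeInTerm (t ⟪ σ ⟫))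
  free-parallel (α ∙ t)   Z∉σ f        = free-parallel t Z∉σ f
  free-parallel (var X)   Z∉σ f        = Z∉σ X f
  free-parallel (t₁ ⊕ t₂) Z∉σ (inj₁ f) = free-parallel t₁ Z∉σ f
  free-parallel (t₁ ⊕ t₂) Z∉σ (inj₂ f) = free-parallel t₂ Z∉σ f
  free-parallel {Z} (μ X t) {σ} Z∉σ (Z≢X , f) = free-parallel t fresh f
    where
    fresh : ∀ Y → ¬ (Z FreeInTerm (σ [ X ↦ var X ]) Y)
    fresh Y with does (X ≟ Y)
    ... | true  = Z≢X
    ... | false = Z∉σ Y

  -- The second hypothesis covers a binder for X itself, below which ⟪ u / X ⟫
  -- does nothing.
  parallel-⟪⟫ : ∀ {X} {u : Term Act} (t : Term Act) {σ σ′} →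
                (∀ Z → (σ Z) ⟪ u / X ⟫ ≡ σ′ Z) →
                (∀ Z → X ≢ Z → σ Z ≡ σ′ Z) →
                (t ⟪ σ ⟫) ⟪ u / X ⟫ ≡ t ⟪ σ′ ⟫
  parallel-⟪⟫ 𝟘         h k = refl
  parallel-⟪⟫ (α ∙ t)   h k = cong (α ∙_) (parallel-⟪⟫ t h k)
  parallel-⟪⟫ ω∙𝟘       h k = refl
  parallel-⟪⟫ (var Y)   h k = h Y
  parallel-⟪⟫ (t₁ ⊕ t₂) h k = cong₂ _⊕_ (parallel-⟪⟫ t₁ h k) (parallel-⟪⟫ t₂ h k)
  parallel-⟪⟫ {X} {u} (μ Y t) {σ} {σ′} h k with does (X ≟ Y) | proof (X ≟ Y)
  ... | _ | ofʸ refl = cong (μ X) (parallel-cong t λ Z _ → agree Z)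
    where
    agree : ∀ Z → (σ [ X ↦ var X ]) Z ≡ (σ′ [ X ↦ var X ]) Z
    agree Z with does (X ≟ Z) | proof (X ≟ Z)
    ... | _ | ofʸ _   = refl
    ... | _ | ofⁿ X≢Z = k Z X≢Z
  ... | _ | ofⁿ X≢Y = cong (μ Y) (parallel-⟪⟫ t h′ k′)
    where
    h′ : ∀ Z → ((σ [ Y ↦ var Y ]) Z) ⟪ u / X ⟫ ≡ (σ′ [ Y ↦ var Y ]) Z
    h′ Z with does (Y ≟ Z)
    ... | true  = ⟪⟫-fresh (var Y) X≢Y
    ... | false = h Z

    k′ : ∀ Z → X ≢ Z → (σ [ Y ↦ var Y ]) Z ≡ (σ′ [ Y ↦ var Y ]) Z
    k′ Z X≢Z with does (Y ≟ Z)
    ... | true  = refl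
    ... | false = k Z X≢Z

  -- Unfolding a substituted recursion is again a parallel substitution into its body `t`, so an
  -- induction on open terms can pass through `μ` although unfolding makes terms grow.
  parallel-unfold : ∀ {X} {u : Term Act} (t : Term Act) {σ} →
                    (∀ Z → ClosedTerm (σ Z)) →
                    (t ⟪ σ [ X ↦ var X ] ⟫) ⟪ u / X ⟫ ≡ t ⟪ σ [ X ↦ u ] ⟫
  parallel-unfold {X} {u} t {σ} cσ = parallel-⟪⟫ t h
    λ Z X≢Z → trans (update-other σ X (var X) X≢Z) (sym (update-other σ X u X≢Z))
    where
    h : ∀ Z → ((σ [ X ↦ var X ]) Z) ⟪ u / X ⟫ ≡ (σ [ X ↦ u ]) Z
    h Z with does (X ≟ Z)
    ... | true  = update-same var X u
    ... | false = ⟪⟫-fresh (σ Z) (cσ Z X)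

-- Denotations of mayHML formulae

module _ {Act : Set} (L : LTS Act) where
  open LTS L
  open Semantics L

  -- Besides monotonicity, this gives independence of the environment for
  -- closed formulae.
  ⟦⟧-mono : ∀ {φ : Formula Act} {ρ ρ′ : Env} → MayFragment φ →
            (∀ X → X FreeIn φ → ρ X ⊆ ρ′ X) → ⟦ φ ⟧ ρ ⊆ ⟦ φ ⟧ ρ′
  ⟦⟧-mono tt        h d            = d
  ⟦⟧-mono (var X)   h (lift d)     = lift (h X refl d)
  ⟦⟧-mono (⟨ α ⟩ m) h (s′ , r , d) = s′ , r , ⟦⟧-mono m h d
  ⟦⟧-mono (m₁ ∨ m₂) h (inj₁ d)     = inj₁ (⟦⟧-mono m₁ (λ X → h X ∘ inj₁) d)
  ⟦⟧-mono (m₁ ∨ m₂) h (inj₂ d)     = inj₂ (⟦⟧-mono m₂ (λ X → h X ∘ inj₂) d)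
  ⟦⟧-mono {min _ φ} {ρ} {ρ′} (min X m) h d P pre =
    d P (pre ∘ ⟦⟧-mono m updated)
    where
    updated : ∀ Z → Z FreeIn φ → (ρ [ X ↦ P ]) Z ⊆ (ρ′ [ X ↦ P ]) Z
    updated Z f with does (X ≟ Z) | proof (X ≟ Z)
    ... | _ | ofʸ _   = λ x → x
    ... | _ | ofⁿ X≢Z = h Z (X≢Z ∘ sym , f)

  τ-Closed : ∀ {ℓ} → Pred S ℓ → Set ℓ
  τ-Closed P = ∀ {s s′} → s =[ τ ]⇒ s′ → P s′ → P s

  -- A diamond absorbs leading τ-moves into its weak transition. For `min`, a pre-fixed point `P`
  -- need not be τ-closed, so it is replaced by its τ-closed interior.
  ⟦⟧-τ-closed : ∀ {φ : Formula Act} {ρ : Env} → MayFragment φ →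
                (∀ X → τ-Closed (ρ X)) → τ-Closed (⟦ φ ⟧ ρ)
  ⟦⟧-τ-closed tt              h r d = d
  ⟦⟧-τ-closed (var X)         h r (lift d) = lift (h X r d)
  ⟦⟧-τ-closed (⟨ τ ⟩ m)       h r (s′ , q , d) = s′ , r ◅◅ q , d
  ⟦⟧-τ-closed (⟨ ext a ⟩ m)   h r (s′ , (u , v , q , x , q′) , d) =
    s′ , (u , v , r ◅◅ q , x , q′) , d
  ⟦⟧-τ-closed (m₁ ∨ m₂)       h r (inj₁ d) = inj₁ (⟦⟧-τ-closed m₁ h r d)
  ⟦⟧-τ-closed (m₁ ∨ m₂)       h r (inj₂ d) = inj₂ (⟦⟧-τ-closed m₂ h r d)
  ⟦⟧-τ-closed {min _ φ} {ρ} (min X m) h r d P pre =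
    d Interior interior-pre r
    where
    -- The largest τ-closed subset of P; it is again a pre-fixed point.
    Interior : Pred S 0ℓ
    Interior s = ∀ {r} → r =[ τ ]⇒ s → P r

    closed : ∀ Z → τ-Closed ((ρ [ X ↦ Interior ]) Z)
    closed Z with does (X ≟ Z)
    ... | true  = λ q i q′ → i (q′ ◅◅ q)
    ... | false = h Z

    shrink : ∀ Z → Z FreeIn φ → (ρ [ X ↦ Interior ]) Z ⊆ (ρ [ X ↦ P ]) Z
    shrink Z _ with does (X ≟ Z)
    ... | true  = λ i → i ε
    ... | false = λ x → x

    interior-pre : ⟦ φ ⟧ (ρ [ X ↦ Interior ]) ⊆ Interior
    -- The induction hypothesis under `Interior` moves `d` back along `q`; only then does
    -- monotonicity enlarge `Interior` to `P`, where `pre` applies.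
    interior-pre d q = pre (⟦⟧-mono m shrink (⟦⟧-τ-closed m closed q d))

  -- Denotations live one universe above environment values, so `X` is assigned an upper bound `P`
  -- of the meaning of `u`. The bound must hold in every environment because binders in `t` change
  -- the one in which `u` is read.
  ⟦⟧-⟪⟫ : ∀ {X} {u : Term Act} {P : Pred S 0ℓ} (t : Term Act) {ρ : Env} →
          (∀ ρ → ⟦ ⌈ u ⌉ ⟧ ρ ⊆ P) →
          ⟦ ⌈ t ⟪ u / X ⟫ ⌉ ⟧ ρ ⊆ ⟦ ⌈ t ⌉ ⟧ (ρ [ X ↦ P ])
  ⟦⟧-⟪⟫ (α ∙ t)   h (s′ , r , d) = s′ , r , ⟦⟧-⟪⟫ t h d
  ⟦⟧-⟪⟫ ω∙𝟘       h d = d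
  ⟦⟧-⟪⟫ {X} (var Y) h d with does (X ≟ Y)
  ... | true  = lift (h _ d)
  ... | false = d
  ⟦⟧-⟪⟫ (t₁ ⊕ t₂) h (inj₁ d) = inj₁ (⟦⟧-⟪⟫ t₁ h d)
  ⟦⟧-⟪⟫ (t₁ ⊕ t₂) h (inj₂ d) = inj₂ (⟦⟧-⟪⟫ t₂ h d)
  ⟦⟧-⟪⟫ {X} {u} {P} (μ Y t) {ρ} h d Q pre with does (X ≟ Y) | proof (X ≟ Y)
  -- Substitution stops at a binder for `X`, and that binder also overwrites the value `P`.
  ... | _ | ofʸ refl = d Q (pre ∘ ⟦⟧-mono (⌈⌉-mayFragment t) λ Z _ → overwrite Z)
    where
    overwrite : ∀ Z → (ρ [ X ↦ Q ]) Z ⊆ ((ρ [ X ↦ P ]) [ X ↦ Q ]) Z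
    overwrite Z with does (X ≟ Z)
    ... | true  = λ x → x
    ... | false = λ x → x
  ... | _ | ofⁿ X≢Y =
    d Q (pre ∘ ⟦⟧-mono (⌈⌉-mayFragment t) (λ Z _ → commute Z) ∘ ⟦⟧-⟪⟫ t h)
    where
    commute : ∀ Z → ((ρ [ Y ↦ Q ]) [ X ↦ P ]) Z ⊆ ((ρ [ X ↦ P ]) [ Y ↦ Q ]) Z
    commute Z with does (X ≟ Z) | proof (X ≟ Z) | does (Y ≟ Z) | proof (Y ≟ Z)
    ... | _ | ofʸ refl | _ | ofʸ refl = ⊥-elim (X≢Y refl)
    ... | _ | ofʸ _    | _ | ofⁿ _    = λ x → x
    ... | _ | ofⁿ _    | _ | ofʸ _    = λ x → x
    ... | _ | ofⁿ _    | _ | ofⁿ _    = λ x → x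

  ∅ᵉ : Env
  ∅ᵉ _ = ∅

  -- Every pre-fixed point `P` of the body contains the denotation of the recursion, whatever the
  -- environment since `μ X t` is closed. The substitution lemma for this `P` then puts `s` in the
  -- body at `P`, hence in `P`.
  ⊨-unfold : ∀ {X} {t : Term Act} {s} → ClosedTerm (μ X t) →
             s ⊨ ⌈ t ⟪ μ X t / X ⟫ ⌉ → s ⊨ ⌈ μ X t ⌉
  ⊨-unfold {X} {t} c d P pre = pre (⟦⟧-⟪⟫ t below d)
    where
    below : ∀ ρ → ⟦ ⌈ μ X t ⌉ ⟧ ρ ⊆ P
    below ρ e = ⟦⟧-mono {ρ = ρ} {∅ᵉ} (⌈⌉-mayFragment (μ X t))
                  (λ Z f → ⊥-elim (c Z (free-⌈⌉ (μ X t) f))) e P pre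

  ⊨-τ-closed : ∀ (t : Term Act) → τ-Closed (_⊨ ⌈ t ⌉)
  ⊨-τ-closed t = ⟦⟧-τ-closed {ρ = ∅ᵉ} (⌈⌉-mayFragment t) λ _ _ ()

  -- Allowing a weak move of the process covers both kinds of test step: the empty move when the
  -- test moves alone, a visible one when they synchronise.
  ⊨-step : ∀ {t t′ : Term Act} {α s s′} → ClosedTerm t → t -⟨ act α ⟩→ t′ →
           s =[ α ]⇒ s′ → s′ ⊨ ⌈ t′ ⌉ → s ⊨ ⌈ t ⌉
  ⊨-step c prefix   r d = _ , r , d
  ⊨-step c (sumˡ x) r d = inj₁ (⊨-step (λ X → c X ∘ inj₁) x r d)
  ⊨-step c (sumʳ x) r d = inj₂ (⊨-step (λ X → c X ∘ inj₂) x r d)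
  ⊨-step c (unfold {X} {t}) r d =
    ⊨-unfold {t = t} c (⊨-τ-closed (t ⟪ μ X t / X ⟫) r d)

  ⊨-success : ∀ {t t′ : Term Act} {s} → t -⟨ ω ⟩→ t′ → s ⊨ ⌈ t ⌉
  ⊨-success success  = _
  ⊨-success (sumˡ x) = inj₁ (⊨-success x)
  ⊨-success (sumʳ x) = inj₂ (⊨-success x)

-- Reachability of success

module _ {Act : Set} (L : LTS Act) where
  open LTS L
  open Semantics L
  open Testing L

  -- A finite path to success, with no maximality required. It lives in `Set`, so for a fixed test
  -- it is an admissible `P` in the semantics of `min`.
  data MaySucceed : Experiment → Set where
    now   : ∀ {e} → CanSucceed e → MaySucceed e
    later : ∀ {e e′} → e ⟶ e′ → MaySucceed e′ → MaySucceed e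

  maySucceed⇒⊨ : ∀ {p t} → ClosedTerm t → MaySucceed (p , t) → p ⊨ ⌈ t ⌉
  maySucceed⇒⊨ c (now (_ , x)) = ⊨-success L x
  maySucceed⇒⊨ {t = t} c (later (process r) m) =
    ⊨-τ-closed L t (r ◅ ε) (maySucceed⇒⊨ c m)
  maySucceed⇒⊨ c (later (test x) m) =
    ⊨-step L c x ε (maySucceed⇒⊨ (closed-step c x) m)
  maySucceed⇒⊨ c (later (sync a r x) m) =
    ⊨-step L c x (_ , _ , ε , r , ε) (maySucceed⇒⊨ (closed-step c x) m)

  maySucceed-τ : ∀ {t p p′} → p =[ τ ]⇒ p′ → MaySucceed (p′ , t) →
                 MaySucceed (p , t)
  maySucceed-τ ε       m = m
  maySucceed-τ (r ◅ q) m = later (process r) (maySucceed-τ q m)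

  maySucceed-prefix : ∀ {t p p′} α → p =[ α ]⇒ p′ → MaySucceed (p′ , t) →
                      MaySucceed (p , α ∙ t)
  maySucceed-prefix τ       q m = maySucceed-τ q (later (test prefix) m)
  maySucceed-prefix (ext a) (_ , _ , q , r , q′) m =
    maySucceed-τ q (later (sync a r prefix) (maySucceed-τ q′ m))

  -- Moves of the process alone leave the choice open; the first move involving the test resolves
  -- it, and the rest of the path is kept.
  maySucceed-⊕ˡ : ∀ {t₁ t₂ p} → MaySucceed (p , t₁) → MaySucceed (p , t₁ ⊕ t₂)
  maySucceed-⊕ˡ (now (_ , x))          = now (_ , sumˡ x)
  maySucceed-⊕ˡ (later (process r) m)  = later (process r) (maySucceed-⊕ˡ m)
  maySucceed-⊕ˡ (later (test x) m)     = later (test (sumˡ x)) m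
  maySucceed-⊕ˡ (later (sync a r x) m) = later (sync a r (sumˡ x)) m

  maySucceed-⊕ʳ : ∀ {t₁ t₂ p} → MaySucceed (p , t₂) → MaySucceed (p , t₁ ⊕ t₂)
  maySucceed-⊕ʳ (now (_ , x))          = now (_ , sumʳ x)
  maySucceed-⊕ʳ (later (process r) m)  = later (process r) (maySucceed-⊕ʳ m)
  maySucceed-⊕ʳ (later (test x) m)     = later (test (sumʳ x)) m
  maySucceed-⊕ʳ (later (sync a r x) m) = later (sync a r (sumʳ x)) m

  -- Generalised to open terms for the induction on `t`: the closing substitution `σ` supplies tests
  -- whose may-success is guaranteed by membership in `ρ`.
  ⟦⟧⇒maySucceed : ∀ (t : Term Act) {ρ : Env} {σ} →
                  (∀ X → ClosedTerm (σ X)) →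
                  (∀ X → ρ X ⊆ λ p → MaySucceed (p , σ X)) →
                  ⟦ ⌈ t ⌉ ⟧ ρ ⊆ λ p → MaySucceed (p , t ⟪ σ ⟫)
  ⟦⟧⇒maySucceed (α ∙ t)   cσ h (_ , q , d) =
    maySucceed-prefix α q (⟦⟧⇒maySucceed t cσ h d)
  ⟦⟧⇒maySucceed ω∙𝟘       cσ h d = now (_ , success)
  ⟦⟧⇒maySucceed (var X)   cσ h (lift d) = h X d
  ⟦⟧⇒maySucceed (t₁ ⊕ t₂) cσ h (inj₁ d) = maySucceed-⊕ˡ (⟦⟧⇒maySucceed t₁ cσ h d)
  ⟦⟧⇒maySucceed (t₁ ⊕ t₂) cσ h (inj₂ d) = maySucceed-⊕ʳ (⟦⟧⇒maySucceed t₂ cσ h d)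
  -- `P` is a pre-fixed point because one unfolding step leads to `t` with `X` sent to the recursion
  -- `u`, to which the induction hypothesis applies.
  ⟦⟧⇒maySucceed (μ X t) {ρ} {σ} cσ h d = d P λ {q} e → later (test unfold)
      (subst (λ v → MaySucceed (q , v)) (sym (parallel-unfold t cσ))
        (⟦⟧⇒maySucceed t closed below e))
    where
    u : Term Act
    u = μ X t ⟪ σ ⟫

    P : Pred S 0ℓ
    P p = MaySucceed (p , u)

    closed : ∀ Z → ClosedTerm ((σ [ X ↦ u ]) Z)
    closed Z with does (X ≟ Z)
    ... | true  = λ Y → free-parallel (μ X t) λ Z → cσ Z Y
    ... | false = cσ Z

    below : ∀ Z → (ρ [ X ↦ P ]) Z ⊆ λ p → MaySucceed (p , (σ [ X ↦ u ]) Z)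
    below Z with does (X ≟ Z)
    ... | true  = λ m → m
    ... | false = h Z

  ⊨⇒maySucceed : ∀ {p t} → ClosedTerm t → p ⊨ ⌈ t ⌉ → MaySucceed (p , t)
  ⊨⇒maySucceed {p} {t} c d = subst (λ v → MaySucceed (p , v)) (parallel-closed c)
    -- Any closed default would do in place of `𝟘`: the environment is empty and `t` is closed.
    (⟦⟧⇒maySucceed t {σ = λ _ → 𝟘} (λ _ _ ()) (λ _ ()) d)

  -- Computations

  maySucceed-finite : ∀ n (state : Fin (ℕ.suc n) → Experiment) →
                      (∀ i → state (inject₁ i) ⟶ state (Fin.suc i)) →
                      ∀ i → CanSucceed (state i) → MaySucceed (state zero)
  maySucceed-finite n         state step zero        x = now x
  maySucceed-finite (ℕ.suc n) state step (Fin.suc i) x =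
    later (step zero)
      (maySucceed-finite n (state ∘ Fin.suc) (step ∘ Fin.suc) i x)

  maySucceed-infinite : ∀ (state : ℕ → Experiment) →
                        (∀ n → state n ⟶ state (ℕ.suc n)) →
                        ∀ n → CanSucceed (state n) → MaySucceed (state 0)
  maySucceed-infinite state step ℕ.zero    x = now x
  maySucceed-infinite state step (ℕ.suc n) x =
    later (step 0) (maySucceed-infinite (state ∘ ℕ.suc) (step ∘ ℕ.suc) n x)

  successful⇒maySucceed : ∀ {e} → Σ (Computation e) Successful → MaySucceed e
  successful⇒maySucceed (finite n state refl step _ , i , x) =
    maySucceed-finite n state step i x
  successful⇒maySucceed
    (infinite record { state = state ; start = refl ; step = step } , n , x) =
    maySucceed-infinite state step n x

  prepend : ∀ {e e′} → e ⟶ e′ → Computation e′ → Computation e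
  prepend {e} r (finite n state refl step stuck) =
    -- The shift leaves the last state unchanged, so `stuck` carries over by computation.
    finite (ℕ.suc n) state′ refl step′ stuck
    where
    state′ : Fin (ℕ.suc (ℕ.suc n)) → Experiment
    state′ zero        = e
    state′ (Fin.suc i) = state i

    step′ : ∀ i → state′ (inject₁ i) ⟶ state′ (Fin.suc i)
    step′ zero        = r
    step′ (Fin.suc i) = step i
  prepend {e} r (infinite record { state = state ; start = refl ; step = step }) =
    infinite record { state = state′ ; start = refl ; step = step′ }
    where
    state′ : ℕ → Experiment
    state′ ℕ.zero    = e
    state′ (ℕ.suc n) = state n

    step′ : ∀ n → state′ n ⟶ state′ (ℕ.suc n)
    step′ ℕ.zero    = r
    step′ (ℕ.suc n) = step n

  prepend-successful : ∀ {e e′} (r : e ⟶ e′) (c : Computation e′) →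
                       Successful c → Successful (prepend r c)
  prepend-successful r (finite _ _ refl _ _) (i , x) = Fin.suc i , x
  prepend-successful r
    (infinite record { state = _ ; start = refl ; step = _ }) (n , x) =
    ℕ.suc n , x

  successful-start : ∀ {e} (c : Computation e) → CanSucceed e → Successful c
  successful-start (finite _ _ refl _ _) x = zero , x
  successful-start
    (infinite record { state = _ ; start = refl ; step = _ }) x = 0 , x

  -- Maximal computations by excluded middle

  module _ (em : ExcludedMiddle (suc 0ℓ)) where

    decide : (A : Set) → Dec A
    decide A = map′ lower lift (em {Lift (suc 0ℓ) A})

    Stuck : Experiment → Set
    Stuck e = ∀ e′ → ¬ (e ⟶ e′)

    Terminable : Experiment → Set
    Terminable e = ∃[ e′ ] Star _⟶_ e e′ × Stuck e′

    terminating : ∀ {e e′} → Star _⟶_ e e′ → Stuck e′ → Computation e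
    terminating {e} ε stuck = finite 0 (λ _ → e) refl (λ ()) stuck
    terminating (r ◅ q) stuck = prepend r (terminating q stuck)

    -- An experiment from which no stuck state is reachable is not itself stuck, and its successors
    -- inherit the property. The decision returns an actual successor, so iteration needs no
    -- separate choice principle.
    continue : ∀ {e} → ¬ Terminable e → ∃[ e′ ] e ⟶ e′ × ¬ Terminable e′
    continue {e} ¬term with decide (∃[ e′ ] e ⟶ e′)
    ... | yes (e′ , r) = e′ , r , λ (f , q , stuck) → ¬term (f , r ◅ q , stuck)
    ... | no stuck     = ⊥-elim (¬term (e , ε , λ e′ r → stuck (e′ , r)))

    nonterminating : ∀ {e} → ¬ Terminable e → InfinitePath _⟶_ e
    nonterminating {e} ¬term = record
      { state = proj₁ ∘ run
      ; start = refl
      ; step  = λ n → proj₁ (proj₂ (continue (proj₂ (run n))))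
      }
      where
      run : ℕ → ∃[ e ] ¬ Terminable e
      run ℕ.zero    = e , ¬term
      run (ℕ.suc n) = let e′ , _ , ¬term′ = continue (proj₂ (run n)) in e′ , ¬term′

    computation : ∀ e → Computation e
    computation e with decide (Terminable e)
    ... | yes (_ , q , stuck) = terminating q stuck
    ... | no ¬term            = infinite (nonterminating ¬term)

    -- Once success is reached, any maximal continuation serves, since the successful state already
    -- lies on the path; the earlier steps are then prepended.
    maySucceed⇒successful : ∀ {e} → MaySucceed e → Σ (Computation e) Successful
    maySucceed⇒successful {e} (now x) =
      computation e , successful-start (computation e) x
    maySucceed⇒successful (later r m) =
      let c , x = maySucceed⇒successful m in prepend r c , prepend-successful r c x

    ⊨⌈⌉⇔maySatisfy : ∀ (t : Test Act) p → p ⊨ ⌈ proj₁ t ⌉ ⇔ p MaySatisfy t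
    ⊨⌈⌉⇔maySatisfy (t , c) p =
      mk⇔ (maySucceed⇒successful ∘ ⊨⇒maySucceed c)
          (maySucceed⇒⊨ c ∘ successful⇒maySucceed)

corollary5p3 : ExcludedMiddle (suc 0ℓ) →
    (Act : Set) → Countable Act → (L : LTS Act) →
    (φ : recHML Act) → Testing.MayTestable L φ →
    Σ (mayHML Act) λ ψ → LogicallyEquivalent L (proj₁ ψ) (proj₁ φ)
corollary5p3 em Act _ L φ ((t , c) , t⇔φ) =
  (⌈ t ⌉ , ⌈⌉-mayFragment t , λ X f → c X (free-⌈⌉ t f)) ,
  λ p → mk⇔ (Equivalence.to (t⇔φ p) ∘ Equivalence.to (⊨⌈⌉⇔maySatisfy L em (t , c) p))
            (Equivalence.from (⊨⌈⌉⇔maySatisfy L em (t , c) p) ∘ Equivalence.from (t⇔φ p))
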